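{- For a tricontext $\mathbb{K}=(K_1,K_2,K_3,I)$, the operators $\sigma_{ijk}(\cdot)$ are not commutative, i.e. $\sigma_{ijk}(\sigma_{lmn}(\cdot))\neq\sigma_{lmn}(\sigma_{ijk}(\cdot))$, where $(i,j,k)\neq(l,m,n)$ and $\{i,j,k\}=\{l,m,n\}=\{1,2,3\}$.
   Context: A tricontext $\mathbb{K}=(K_1,K_2,K_3,I)$ consists of sets $K_1,K_2,K_3$ and a relation $I\subseteq K_1\times K_2\times K_3$. For $\{i,j,k\}=\{1,2,3\}$, $P\subseteq K_j$ and $Q\subseteq K_k$, put $(P\times Q)^{(i)}=\{x_i\in K_i\mid x_i,x_j,x_k\text{ are related by }I\text{ for all }x_j\in P,\ x_k\in Q\}$, where "related by $I$" means that the triple of these elements, arranged in the order $K_1,K_2,K_3$, belongs to $I$. For each $(i,j,k)$ with $\{i,j,k\}=\{1,2,3\}$ the operator $\sigma_{ijk}:2^{K_1}\times 2^{K_2}\times 2^{K_3}\to 2^{K_1}\times 2^{K_2}\times 2^{K_3}$ maps $(X_1,X_2,X_3)$ to $(Y_1,Y_2,Y_3)$, where $Y_i=(X_j\times X_k)^{(i)}$, $Y_j=(Y_i\times X_k)^{(j)}$ and $Y_k=(Y_i\times Y_j)^{(k)}$. -}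

module Defs where

open import Data.Fin using (Fin)
open import Data.Fin.Patterns using (0F; 1F; 2F)
open import Data.Product using (_×_; _,_)
open import Level using (Level; 0ℓ)
open import Relation.Unary using (Pred; _∈_; _≐_)

private
  variable
    ℓ : Level
    i j k : Fin 3

-- The positions 1, 2, 3 are the elements 0F, 1F, 2F of Fin 3.

-- Arrangement i j k states that {i , j , k} is the whole of Fin 3.
data Arrangement : Fin 3 → Fin 3 → Fin 3 → Set where
  a123 : Arrangement 0F 1F 2F
  a132 : Arrangement 0F 2F 1F
  a213 : Arrangement 1F 0F 2F
  a231 : Arrangement 1F 2F 0F
  a312 : Arrangement 2F 0F 1F
  a321 : Arrangement 2F 1F 0F

-- (i , j , k) ↦ (j , i , k)
swap : Arrangement i j k → Arrangement j i k
swap a123 = a213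
swap a132 = a312
swap a213 = a123
swap a231 = a321
swap a312 = a132
swap a321 = a231

-- (i , j , k) ↦ (k , i , j)
rotate : Arrangement i j k → Arrangement k i j
rotate a123 = a312
rotate a132 = a213
rotate a213 = a321
rotate a231 = a123
rotate a312 = a231
rotate a321 = a132

Triple : (Fin 3 → Set ℓ) → Set ℓ
Triple F = F 0F × F 1F × F 2F

component : (F : Fin 3 → Set ℓ) → Triple F → ∀ m → F m
component F (x , y , z) 0F = x
component F (x , y , z) 1F = y
component F (x , y , z) 2F = z

-- The triple with u, v, w at the positions i, j, k respectively.
arrange : (F : Fin 3 → Set ℓ) → Arrangement i j k → F i → F j → F k → Triple F
arrange F a123 u v w = u , v , w
arrange F a132 u v w = u , w , v
arrange F a213 u v w = v , u , w
arrange F a231 u v w = w , u , v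
arrange F a312 u v w = v , w , u
arrange F a321 u v w = w , v , u

record Tricontext : Set₁ where
  field
    K : Fin 3 → Set
    I : Pred (Triple K) 0ℓ

  Subset : Fin 3 → Set₁
  Subset m = Pred (K m) 0ℓ

  -- (P × Q)⁽ⁱ⁾
  derive : Arrangement i j k → Subset j → Subset k → Subset i
  derive p P Q xᵢ = ∀ xⱼ xₖ → xⱼ ∈ P → xₖ ∈ Q → arrange K p xᵢ xⱼ xₖ ∈ I

  σ : Arrangement i j k → Triple Subset → Triple Subset
  σ {i} {j} {k} p X = arrange Subset p Yᵢ Yⱼ Yₖ
    where
    Xⱼ : Subset j
    Xⱼ = component Subset X j
    Xₖ : Subset k
    Xₖ = component Subset X k
    Yᵢ : Subset i
    Yᵢ = derive p Xⱼ Xₖ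
    Yⱼ : Subset j
    Yⱼ = derive (swap p) Yᵢ Xₖ
    Yₖ : Subset k
    Yₖ = derive (rotate p) Yᵢ Yⱼ

  -- Equality of triples of subsets is extensional.
  infix 4 _≋_
  _≋_ : Triple Subset → Triple Subset → Set
  X ≋ Y = ∀ m → component Subset X m ≐ component Subset Y m

{-# OPTIONS --safe #-}

-- Over one-point sets with empty relation, the concepts are the triples with exactly one
-- empty component, and every σ fixes them.  So σ p and σ q fail to commute at X as soon as
-- σ p X and σ q X differ.  With all components of X full, the gap of σᵢⱼₖ X is at i; with
-- all of them empty, it is at k.  Distinct arrangements differ in i or in k.
module Submission where

open import Defs
open import Data.Empty using (⊥)
open import Data.Fin using (Fin; _≟_)
open import Data.Fin.Patterns using (0F; 1F; 2F)
open import Data.Product using (Σ-syntax; _,_; proj₂)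
open import Data.Unit using (⊤; tt)
open import Function.Base using (_∘_)
open import Function.Bundles using (_⇔_; mk⇔; Equivalence)
open import Relation.Binary.PropositionalEquality using (_≡_; _≢_; refl; sym)
open import Relation.Nullary using (¬_; yes; no; contradiction)
open import Relation.Nullary.Decidable using (decidable-stable)
open import Relation.Unary using (_∈_; ∅; U)

open Equivalence using (to; from)

private
  variable
    i j k l m n a b : Fin 3

distinct : Arrangement i j k → i ≢ j
distinct a123 ()
distinct a132 ()
distinct a213 ()
distinct a231 ()
distinct a312 ()
distinct a321 ()

-- `P` holds trivially at `i`, `j` and `k`; arranging these three proofs into a triple lets
-- `component` look one up at any `a`.
exhaustive : Arrangement i j k → ∀ a → i ≢ a → j ≢ a → k ≢ a → ⊥
exhaustive {i} {j} {k} p = component P (arrange P p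
  (λ i≢i _ _ → i≢i refl) (λ _ j≢j _ → j≢j refl) (λ _ _ k≢k → k≢k refl))
  where
  P : Fin 3 → Set
  P a = i ≢ a → j ≢ a → k ≢ a → ⊥

arrange-elim : ∀ {ℓ ℓ′} (F : Fin 3 → Set ℓ) (P : ∀ m → F m → Set ℓ′)
               (p : Arrangement i j k) {u : F i} {v : F j} {w : F k} →
               P i u → P j v → P k w → ∀ m → P m (component F (arrange F p u v w) m)
arrange-elim F P a123 x y z = λ { 0F → x ; 1F → y ; 2F → z }
arrange-elim F P a132 x y z = λ { 0F → x ; 1F → z ; 2F → y }
arrange-elim F P a213 x y z = λ { 0F → y ; 1F → x ; 2F → z }
arrange-elim F P a231 x y z = λ { 0F → z ; 1F → x ; 2F → y }
arrange-elim F P a312 x y z = λ { 0F → y ; 1F → z ; 2F → x }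
arrange-elim F P a321 x y z = λ { 0F → z ; 1F → y ; 2F → x }

-- If both ends agreed, the middles would differ, and `j` would then avoid all three entries of `q`.
first-or-last-differs : Arrangement i j k → Arrangement l m n →
                        (i , j , k) ≢ (l , m , n) → i ≡ l → k ≢ n
first-or-last-differs {j = j} {m = m} p q ijk≢lmn refl refl with j ≟ m
... | yes refl = ijk≢lmn refl
... | no j≢m = exhaustive q j (distinct p) (j≢m ∘ sym) (distinct (rotate (swap p)))

emptyPoint : Tricontext
emptyPoint = record { K = λ _ → ⊤ ; I = ∅ }

module EmptyPoint where

  open Tricontext emptyPoint

  full empty : Triple Subset
  full  = U , U , U
  empty = ∅ , ∅ , ∅

  component-full : ∀ m → tt ∈ component Subset full m
  component-full = λ { 0F → tt ; 1F → tt ; 2F → tt }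

  component-empty : ∀ m → ¬ tt ∈ component Subset empty m
  component-empty = λ { 0F () ; 1F () ; 2F () }

  GapAt : Fin 3 → ∀ m → Subset m → Set
  GapAt a m P = tt ∈ P ⇔ m ≢ a

  Gap : Fin 3 → Triple Subset → Set
  Gap a X = ∀ m → GapAt a m (component Subset X m)

  -- Otherwise `Y` is full at `a`, where `X` is empty. Decidable equality on `Fin 3` turns this
  -- refutation into a proof.
  gap-unique : ∀ {X Y} → X ≋ Y → Gap a X → Gap b Y → a ≡ b
  gap-unique {a} {b} X≋Y gX gY = decidable-stable (a ≟ b)
    λ a≢b → to (gX a) (proj₂ (X≋Y a) (from (gY a) a≢b)) refl

  -- As `I` is empty, the derivation is full exactly when `P` or `Q` is empty. If `i` is `a`, both
  -- are full; otherwise `a` is `j` or `k`, so one of them is empty.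
  derive-gap : (p : Arrangement i j k) {P : Subset j} {Q : Subset k} →
               GapAt a j P → GapAt a k Q → GapAt a i (derive p P Q)
  derive-gap {a = a} p gP gQ = mk⇔
    (λ { d refl → d tt tt (from gP (distinct (swap p))) (from gQ (distinct (rotate p))) })
    (λ i≢a _ _ x y → exhaustive p a i≢a (to gP x) (to gQ y))

  -- Split off from `σ-gap` for the sake of `σ-empty`, where the component at `j` is empty and so
  -- does not fit a gap at `k`.
  σ-gap-from-first : (p : Arrangement i j k) (X : Triple Subset) →
                     GapAt a i (derive p (component Subset X j) (component Subset X k)) →
                     GapAt a k (component Subset X k) → Gap a (σ p X)
  σ-gap-from-first {a = a} p X gYᵢ gXₖ = arrange-elim Subset (GapAt a) p gYᵢ gYⱼ
    (derive-gap (rotate p) gYᵢ gYⱼ)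
    where gYⱼ = derive-gap (swap p) gYᵢ gXₖ

  σ-gap : (p : Arrangement i j k) (X : Triple Subset) →
          GapAt a j (component Subset X j) → GapAt a k (component Subset X k) → Gap a (σ p X)
  σ-gap p X gXⱼ gXₖ = σ-gap-from-first p X (derive-gap p gXⱼ gXₖ) gXₖ

  σ-full : (p : Arrangement i j k) → Gap i (σ p full)
  σ-full {j = j} {k = k} p = σ-gap p full
    (mk⇔ (λ _ → distinct (swap p)) (λ _ → component-full j))
    (mk⇔ (λ _ → distinct (rotate p)) (λ _ → component-full k))

  σ-empty : (p : Arrangement i j k) → Gap k (σ p empty)
  σ-empty {j = j} {k = k} p = σ-gap-from-first p empty
    -- The first derivation is vacuously full, its premise at `j` being empty.
    (mk⇔ (λ _ → distinct (rotate p) ∘ sym) (λ _ _ _ x _ → component-empty j x))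
    (mk⇔ (λ x → contradiction x (component-empty k)) (contradiction refl))

  -- The outer operator preserves the gap made by the inner one, so the two composites have their
  -- gaps at `b` and at `a`.
  gaps-differ⇒¬commute : (p : Arrangement i j k) (q : Arrangement l m n) (X : Triple Subset) →
                         Gap a (σ p X) → Gap b (σ q X) → a ≢ b →
                         ¬ (σ p (σ q X) ≋ σ q (σ p X))
  gaps-differ⇒¬commute {j = j} {k = k} {m = m} {n = n} p q X gp gq a≢b eq =
    a≢b (sym (gap-unique eq (σ-gap p (σ q X) (gq j) (gq k)) (σ-gap q (σ p X) (gp m) (gp n))))

open EmptyPoint

proposition6 : ∀ {i j k l m n : Fin 3} (p : Arrangement i j k) (q : Arrangement l m n) →
    (i , j , k) ≢ (l , m , n) →
    Σ[ 𝕂 ∈ Tricontext ] (let open Tricontext 𝕂 in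
    Σ[ X ∈ Triple Subset ] ¬ (σ p (σ q X) ≋ σ q (σ p X)))
proposition6 {i} {l = l} p q ijk≢lmn with i ≟ l
... | no i≢l = emptyPoint , full , gaps-differ⇒¬commute p q full (σ-full p) (σ-full q) i≢l
... | yes i≡l = emptyPoint , empty , gaps-differ⇒¬commute p q empty (σ-empty p) (σ-empty q)
                  (first-or-last-differs p q ijk≢lmn i≡l)
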